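{- Let $k\ge 1$ and let $X_1,\dots,X_k$ be pairwise disjoint finite nonempty sets with $|X_i|=n_i$. Let $\mathrm{EC}$ be the set of eventually constant $k$-tuples $(f_1,\dots,f_k)$ of functions $f_i:X_i\to X_{i+1}$ (indices modulo $k$). Then $$\#\mathrm{EC}=\prod_{i=1}^k n_i^{\,n_{i-1}-1}\cdot\left(\prod_{j=1}^k n_j-\prod_{j=1}^k(n_j-1)\right).$$
   Context: Indices are modulo $k$, so $X_{k+1}=X_1$ and $n_0=n_k$. A $k$-tuple $(f_1,\dots,f_k)$ with $f_i:X_i\to X_{i+1}$ is eventually constant if the iterates of the composition $f_k\cdots f_1:X_1\to X_1$ eventually stabilize to a constant map, i.e. $(f_k\cdots f_1)^m$ is constant for some $m\ge1$. -}

module Defs where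

open import Data.Fin.Base using (Fin; zero; suc; inject₁; fromℕ)
open import Data.Fin.Relation.Unary.Top
  using (view; ‵fromℕ; ‵inject₁; view-fromℕ; view-inject₁)
open import Data.Nat.Base using (ℕ; zero; suc; _*_; _≤_)
open import Data.Product.Base using (Σ; ∃-syntax; _×_; proj₁)
open import Data.Vec.Functional using (foldr)
open import Function.Base using (_∘_)
open import Function.Bundles using (Inverse)
import Function.Endo.Propositional as Endo
open import Level using (Level)
open import Relation.Binary.Bundles using (Setoid)
import Relation.Binary.Construct.On as On
open import Relation.Binary.PropositionalEquality
  using (_≡_; refl; sym; trans; subst; setoid)

private
  variable
    a ℓ : Level
    m : ℕ

∏ : ∀ {k} → (Fin k → ℕ) → ℕ
∏ = foldr _*_ 1

-- Indices modulo k = suc m: position i of the cycle, 1 ≤ i ≤ k, is the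
-- element of Fin k with value i - 1, so `fromℕ m` stands for k.

next : Fin (suc m) → Fin (suc m)
next i with view i
... | ‵fromℕ     = zero
... | ‵inject₁ j = suc j

prev : Fin (suc m) → Fin (suc m)
prev zero    = fromℕ _
prev (suc j) = inject₁ j

next-fromℕ : ∀ m → next (fromℕ m) ≡ zero
next-fromℕ m rewrite view-fromℕ m = refl

next-inject₁ : (j : Fin m) → next (inject₁ j) ≡ suc j
next-inject₁ j rewrite view-inject₁ j = refl

Tuple : (Fin (suc m) → Set a) → Set a
Tuple X = ∀ i → X i → X (next i)

-- Without function extensionality, tuples of functions are compared pointwise.
tupleSetoid : (Fin (suc m) → Set a) → Setoid a a
tupleSetoid X = record
  { Carrier       = Tuple X
  ; _≈_           = λ f g → ∀ i x → f i x ≡ g i x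
  ; isEquivalence = record
    { refl  = λ i x → refl
    ; sym   = λ p i x → sym (p i x)
    ; trans = λ p q i x → trans (p i x) (q i x)
    }
  }

-- From g₁ , … , gₘ with gᵢ : X i → X (i + 1), the composite gₘ ∘ ⋯ ∘ g₁
-- (the identity when m = 0).
chain : (X : Fin (suc m) → Set a) →
        (∀ j → X (inject₁ j) → X (suc j)) → X zero → X (fromℕ m)
chain {m = zero}  X g x = x
chain {m = suc m} X g x = chain (X ∘ suc) (g ∘ suc) (g zero x)

-- The composite fₖ ∘ ⋯ ∘ f₁; the substitutions only identify `next i` with
-- the index it equals.
composite : (X : Fin (suc m) → Set a) → Tuple X → X zero → X zero
composite {m = m} X f =
  subst X (next-fromℕ m) ∘ f (fromℕ m) ∘
  chain X (λ j → subst X (next-inject₁ j) ∘ f (inject₁ j))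

IsConstant : {A : Set a} {B : Set ℓ} → (A → B) → Set _
IsConstant g = ∃[ c ] ∀ x → g x ≡ c

EventuallyConstant : (X : Fin (suc m) → Set a) → Tuple X → Set a
EventuallyConstant X f = ∃[ r ] 1 ≤ r × IsConstant (composite X f ^ r)
  where open Endo (X zero) using (_^_)

-- Only the tuples are compared, not the proofs of eventual constancy, so each
-- eventually constant tuple counts once.
EC : (Fin (suc m) → Set a) → Setoid a a
EC X = On.setoid {B = Σ (Tuple X) (EventuallyConstant X)} (tupleSetoid X) proj₁

HasCardinality : Setoid a ℓ → ℕ → Set _
HasCardinality S n = Inverse S (setoid (Fin n))

{-# OPTIONS --safe #-}

-- Cut the cycle at X₁ and write the composite as h ∘ g, where g : X₁ → Xₖ is the
-- composite of f₁ , … , fₖ₋₁ and h = fₖ.  The tuple is eventually constant iff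
-- g ∘ h : Xₖ → Xₖ has a fixed point x₀ to which every point flows.
--
-- Counting h for a fixed g: choose x₀, then h x₀ in the fibre g⁻¹(x₀).  The
-- other values of h must make the functional graph acyclic apart from x₀; a
-- uniformly random choice does so with probability |g⁻¹(x₀)| / |X₁|, as one sees
-- by revealing h at one vertex and contracting that vertex into its image.
-- Hence n₁ · #h = n₁ ^ (nₖ - 1) · #{(i , j) ∈ X₁² | g i = g j}.
--
-- Counting g: two distinct points are kept apart by a random map into a set of
-- size n with probability (n - 1) / n, so by the random composite g with
-- probability ∏ (nᵢ - 1) / nᵢ over 2 ≤ i ≤ k.

module Submission where

open import Defs
open import Algebra.Properties.Semiring.Sum as Sum using ()
open import Data.Fin.Base using (Fin; zero; suc; combine; remQuot; punchIn; punchOut; _↑ˡ_; _↑ʳ_; inject₁; fromℕ)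
open import Data.Fin.Properties using (_≟_; any?; combine-remQuot; remQuot-combine; ∀-cons; suc-injective; punchIn-punchOut; punchInᵢ≢i)
open import Data.Fin.Relation.Unary.Top using (View; view; ‵fromℕ; ‵inject₁; view-fromℕ; view-inject₁)
open import Data.Nat.Base using (ℕ; zero; suc; NonZero; _+_; _*_; _∸_; _^_; _⊔_; _≤_; z≤n; s≤s; _≤′_; ≤′-refl; ≤′-step)
import Data.Nat.Properties as ℕ
open import Data.Nat.Solver using (module +-*-Solver)
open import Data.Product.Base using (Σ; ∃; ∃-syntax; _×_; _,_; proj₁; proj₂; map; uncurry)
open import Data.Product.Relation.Binary.Pointwise.NonDependent using (×-setoid)
open import Data.Vec.Functional using (insertAt)
open import Data.Vec.Functional.Properties using (insertAt-lookup; insertAt-punchIn)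
open import Function.Base using (_∘_; id)
open import Function.Bundles using (Inverse)
import Function.Construct.Composition as Compose
import Function.Endo.Propositional as Endo
open import Level using (Level)
open import Relation.Binary.Bundles using (Setoid)
import Relation.Binary.Construct.On as On
open import Relation.Binary.PropositionalEquality
  using (_≡_; _≢_; _≗_; refl; sym; trans; cong; cong₂; subst; subst-subst-sym; subst-sym-subst; setoid; module ≡-Reasoning)
open import Relation.Nullary.Decidable using (Dec; yes; no; ¬?; _×-dec_; map′)
open import Relation.Nullary.Negation using (¬_; contradiction)

open Sum ℕ.+-*-semiring
open ≡-Reasoning
open +-*-Solver using (solve; _:+_; _:*_; _:=_; con)

private
  variable
    a b ℓ ℓ′ ℓ₁ ℓ₂ : Level
    k m n t y : ℕ

-- Finite sums over setoids

sum-+ : (φ : Fin (m + n) → ℕ) →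
  sum φ ≡ sum (φ ∘ (_↑ˡ n)) + sum (φ ∘ (m ↑ʳ_))
sum-+ {zero}  φ = refl
sum-+ {suc m} φ = trans (cong (φ zero +_) (sum-+ {m} (φ ∘ suc))) (sym (ℕ.+-assoc (φ zero) _ _))

sum-* : (φ : Fin (m * n) → ℕ) →
  sum φ ≡ ∑[ i < m ] ∑[ j < n ] φ (combine i j)
sum-* {zero}      φ = refl
sum-* {suc m} {n} φ = trans (sum-+ {n} φ) (cong (sum (φ ∘ (_↑ˡ (m * n))) +_) (sum-* {m} (φ ∘ (n ↑ʳ_))))

sum-const : ∀ n c → ∑[ i < n ] c ≡ n * c
sum-const zero    c = refl
sum-const (suc n) c = cong (c +_) (sum-const n c)

-- Indicators of decidable propositions

𝟙 : {P : Set ℓ₁} → Dec P → ℕ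
𝟙 (yes _) = 1
𝟙 (no  _) = 0

module _ {P : Set ℓ₁} {Q : Set ℓ₂} where

  𝟙-cong : (P → Q) → (Q → P) → (P? : Dec P) (Q? : Dec Q) → 𝟙 P? ≡ 𝟙 Q?
  𝟙-cong f g (yes p) (yes q) = refl
  𝟙-cong f g (yes p) (no ¬q) = contradiction (f p) ¬q
  𝟙-cong f g (no ¬p) (yes q) = contradiction (g q) ¬p
  𝟙-cong f g (no ¬p) (no ¬q) = refl

  𝟙-× : (P? : Dec P) (Q? : Dec Q) → 𝟙 (P? ×-dec Q?) ≡ 𝟙 P? * 𝟙 Q?
  𝟙-× (yes p) (yes q) = refl
  𝟙-× (yes p) (no ¬q) = refl
  𝟙-× (no ¬p) Q?      = refl

𝟙-yes : {P : Set ℓ₁} (P? : Dec P) → P → 𝟙 P? ≡ 1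
𝟙-yes (yes _) p = refl
𝟙-yes (no ¬p) p = contradiction p ¬p

𝟙-no : {P : Set ℓ₁} (P? : Dec P) → ¬ P → 𝟙 P? ≡ 0
𝟙-no (yes p) ¬p = contradiction p ¬p
𝟙-no (no _)  ¬p = refl

𝟙-¬ : {P : Set ℓ₁} (P? : Dec P) → 𝟙 P? + 𝟙 (¬? P?) ≡ 1
𝟙-¬ (yes _) = refl
𝟙-¬ (no _)  = refl

sum-≟ : (i : Fin n) → ∑[ j < n ] 𝟙 (i ≟ j) ≡ 1
sum-≟ {suc n} zero = cong suc (trans
  (sum-cong-≗ {n} (λ j → 𝟙-no (zero ≟ suc j) λ ()))
  (sum-replicate-zero n))
sum-≟ {suc n} (suc i) = trans
  (sum-cong-≗ {n} (λ j → 𝟙-cong suc-injective (cong suc) (suc i ≟ suc j) (i ≟ j)))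
  (sum-≟ i)

-- Lets a property whose witness is unique be counted by summing over the candidate witnesses; it
-- serves for the fixed point of a collapsing map.
𝟙-any : {P : Fin n → Set ℓ₁} (P? : ∀ i → Dec (P i)) →
  (∀ {i j} → P i → P j → i ≡ j) → ∑[ i < n ] 𝟙 (P? i) ≡ 𝟙 (any? P?)
𝟙-any {n} P? unique with any? P?
... | yes (i , p) = trans
  (sum-cong-≗ {n} (λ j → 𝟙-cong (unique p) (λ { refl → p }) (P? j) (i ≟ j)))
  (sum-≟ i)
... | no ¬∃p = trans
  (sum-cong-≗ {n} (λ j → 𝟙-no (P? j) (λ p → ¬∃p (j , p))))
  (sum-replicate-zero n)

-- Bijections of setoids and subsetoids

module _ (S : Setoid a ℓ) (T : Setoid b ℓ′) where
  private
    module S = Setoid S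
    module T = Setoid T

  mkInverse : (to : S.Carrier → T.Carrier) (from : T.Carrier → S.Carrier) →
    (∀ {x y} → x S.≈ y → to x T.≈ to y) → (∀ {x y} → x T.≈ y → from x S.≈ from y) →
    (∀ y → to (from y) T.≈ y) → (∀ x → from (to x) S.≈ x) → Inverse S T
  mkInverse to from to-cong from-cong to∘from from∘to = record
    { to        = to
    ; from      = from
    ; to-cong   = to-cong
    ; from-cong = from-cong
    ; inverse   = (λ eq → T.trans (to-cong eq) (to∘from _))
                , (λ eq → S.trans (from-cong eq) (from∘to _))
    }

-- Equality ignores the proofs of `P`, exactly as in `EC`, so an element with several proofs counts
-- once.
Subsetoid : (S : Setoid a ℓ) → (Setoid.Carrier S → Set ℓ₁) → Setoid _ _
Subsetoid S P = On.setoid {B = Σ (Setoid.Carrier S) P} S proj₁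

Subsetoid-inverse : {S : Setoid a ℓ} {T : Setoid b ℓ′}
  {P : Setoid.Carrier S → Set ℓ₁} {Q : Setoid.Carrier T → Set ℓ₂} (i : Inverse S T) →
  (∀ {x} → P x → Q (Inverse.to i x)) → (∀ {y} → Q y → P (Inverse.from i y)) →
  Inverse (Subsetoid S P) (Subsetoid T Q)
Subsetoid-inverse {S = S} {T} {P} {Q} i P⇒Q Q⇒P = mkInverse (Subsetoid S P) (Subsetoid T Q)
  (map to P⇒Q) (map from Q⇒P) to-cong from-cong
  (strictlyInverseˡ ∘ proj₁) (strictlyInverseʳ ∘ proj₁)
  where open Inverse i

subset-cardinality-suc : {P : Fin (suc n) → Set ℓ₁} (P₀? : Dec (P zero)) →
  HasCardinality (Subsetoid (setoid (Fin n)) (P ∘ suc)) k →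
  HasCardinality (Subsetoid (setoid (Fin (suc n))) P) (𝟙 P₀? + k)
subset-cardinality-suc {P = P} (yes p₀) card = mkInverse _ _ to from
  (λ { {zero , _} {zero , _} refl → refl
     ; {suc i , p} {suc _ , q} refl → cong suc (to-cong {i , p} {i , q} refl) })
  (λ { refl → refl })
  (λ { zero → refl ; (suc r) → cong suc (strictlyInverseˡ r) })
  (λ { (zero , _) → refl ; (suc i , p) → cong suc (strictlyInverseʳ (i , p)) })
  where
  open Inverse card hiding (to; from)
  to : ∃ P → Fin _
  to (zero  , _) = zero
  to (suc i , p) = suc (Inverse.to card (i , p))
  from : Fin _ → ∃ P
  from zero    = zero , p₀
  from (suc r) = map suc id (Inverse.from card r)
subset-cardinality-suc {P = P} (no ¬p₀) card = mkInverse _ _ to (map suc id ∘ from)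
  (λ { {zero , p} _ → contradiction p ¬p₀
     ; {suc i , p} {suc _ , q} refl → to-cong {i , p} {i , q} refl })
  (λ { refl → refl })
  strictlyInverseˡ
  (λ { (zero , p) → contradiction p ¬p₀ ; (suc i , p) → cong suc (strictlyInverseʳ (i , p)) })
  where
  open Inverse card hiding (to)
  to : ∃ P → Fin _
  to (zero  , p) = contradiction p ¬p₀
  to (suc i , p) = Inverse.to card (i , p)

subset-cardinality : {P : Fin n → Set ℓ₁} (P? : ∀ i → Dec (P i)) →
  HasCardinality (Subsetoid (setoid (Fin n)) P) (∑[ i < n ] 𝟙 (P? i))
subset-cardinality {zero} P? = mkInverse _ _ (λ ()) (λ ()) (λ { {()} }) (λ { {()} }) (λ ()) (λ ())
subset-cardinality {suc n} P? = subset-cardinality-suc (P? zero) (subset-cardinality (P? ∘ suc))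

-- Enumerated setoids and sums over them

record Enumeration (S : Setoid a ℓ) : Set (a Level.⊔ ℓ) where
  field
    size        : ℕ
    enumeration : HasCardinality S size
  open Inverse enumeration public

-- One representative `from i` of each class is summed. Lemmas that pass to other representatives
-- therefore ask that `φ` respect equality.
∑ₑ : {S : Setoid a ℓ} → Enumeration S → (Setoid.Carrier S → ℕ) → ℕ
∑ₑ E φ = sum (φ ∘ Enumeration.from E)

module _ {S : Setoid a ℓ} (E : Enumeration S) where
  open Setoid S using (Carrier; _≈_)
  open Enumeration E

  ∑ₑ-cong : {φ ψ : Carrier → ℕ} → φ ≗ ψ → ∑ₑ E φ ≡ ∑ₑ E ψ
  ∑ₑ-cong eq = sum-cong-≗ {size} (eq ∘ from)

  ∑ₑ-const : ∀ c → ∑ₑ E (λ _ → c) ≡ size * c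
  ∑ₑ-const = sum-const size

  ∑ₑ-+ : (φ ψ : Carrier → ℕ) → ∑ₑ E (λ x → φ x + ψ x) ≡ ∑ₑ E φ + ∑ₑ E ψ
  ∑ₑ-+ φ ψ = ∑-distrib-+ (φ ∘ from) (ψ ∘ from)

  ∑ₑ-*ˡ : ∀ c (φ : Carrier → ℕ) → ∑ₑ E (λ x → c * φ x) ≡ c * ∑ₑ E φ
  ∑ₑ-*ˡ c φ = sym (*-distribˡ-sum c (φ ∘ from))

  ∑ₑ-sum-comm : (φ : Carrier → Fin n → ℕ) →
    ∑ₑ E (λ x → ∑[ i < n ] φ x i) ≡ ∑[ i < n ] ∑ₑ E (λ x → φ x i)
  ∑ₑ-sum-comm φ = ∑-comm (φ ∘ from)

  subsetoid-cardinality : {P : Carrier → Set ℓ₁} (P? : ∀ x → Dec (P x)) →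
    (∀ {x y} → x ≈ y → P x → P y) →
    HasCardinality (Subsetoid S P) (∑ₑ E (λ x → 𝟙 (P? x)))
  subsetoid-cardinality P? resp = Compose.inverse
    -- The proof of `P x` has to move to the representative `from (to x)`, which is only `≈`-equal
    -- to `x`.
    (Subsetoid-inverse enumeration (resp (Setoid.sym S (strictlyInverseʳ _))) id)
    (subset-cardinality (P? ∘ from))

finite : ∀ n → Enumeration (setoid (Fin n))
finite n = record { size = n ; enumeration = mkInverse _ _ id id id id (λ _ → refl) (λ _ → refl) }

-- Enumerations of products and function spaces

_×ₑ_ : {S : Setoid a ℓ} {T : Setoid b ℓ′} → Enumeration S → Enumeration T → Enumeration (×-setoid S T)
_×ₑ_ {S = S} {T = T} E F = record
  { size        = E.size * F.size
  ; enumeration = mkInverse (×-setoid S T) (setoid (Fin (E.size * F.size)))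
      (λ (x , y) → combine (E.to x) (F.to y))
      (map E.from F.from ∘ remQuot F.size)
      (λ (x≈x′ , y≈y′) → cong₂ combine (E.to-cong x≈x′) (F.to-cong y≈y′))
      (λ { refl → S.refl , T.refl })
      (λ i → trans
        (cong₂ combine (E.strictlyInverseˡ _) (F.strictlyInverseˡ _))
        (combine-remQuot {E.size} F.size i))
      (λ (x , y) → subst
        (λ ij → Setoid._≈_ (×-setoid S T) (map E.from F.from ij) (x , y))
        (sym (remQuot-combine (E.to x) (F.to y)))
        (E.strictlyInverseʳ x , F.strictlyInverseʳ y))
  }
  where
  module S = Setoid S
  module T = Setoid T
  module E = Enumeration E
  module F = Enumeration F

∑ₑ-× : {S : Setoid a ℓ} {T : Setoid b ℓ′} (E : Enumeration S) (F : Enumeration T)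
  (φ : Setoid.Carrier (×-setoid S T) → ℕ) →
  ∑ₑ (E ×ₑ F) φ ≡ ∑ₑ E (λ x → ∑ₑ F (λ y → φ (x , y)))
∑ₑ-× E F φ = trans (sum-* {E.size} _)
  (sum-cong-≗ {E.size} λ i → sum-cong-≗ {F.size} λ j →
    cong (φ ∘ map E.from F.from) (remQuot-combine i j))
  where
  module E = Enumeration E
  module F = Enumeration F

Πˢ : (Fin k → Setoid a ℓ) → Setoid a ℓ
Πˢ S = record
  { Carrier       = ∀ i → S.Carrier i
  ; _≈_           = λ f g → ∀ i → S._≈_ i (f i) (g i)
  ; isEquivalence = record
    { refl  = λ i → S.refl i
    ; sym   = λ p i → S.sym i (p i)
    ; trans = λ p q i → S.trans i (p i) (q i)
    }
  }
  where module S i = Setoid (S i)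

Πₑ : {S : Fin k → Setoid a ℓ} → (∀ i → Enumeration (S i)) → Enumeration (Πˢ S)
Πₑ {zero} {S = S} E = record
  { size        = 1
  ; enumeration = mkInverse (Πˢ S) _ (λ _ → zero) (λ _ ()) (λ _ → refl) (λ _ ())
      (λ { zero → refl }) (λ _ ())
  }
Πₑ {suc k} {S = S} E = record
  { size        = size
  ; enumeration = Compose.inverse
      (mkInverse (Πˢ S) (×-setoid (S zero) (Πˢ (S ∘ suc)))
        (λ f → f zero , f ∘ suc) (uncurry ∀-cons)
        (λ f≈g → f≈g zero , f≈g ∘ suc) (uncurry ∀-cons)
        (λ _ → Setoid.refl (×-setoid (S zero) (Πˢ (S ∘ suc))))
        (λ f → ∀-cons (S.refl zero) (λ i → S.refl (suc i))))
      enumeration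
  }
  where
  open Enumeration (E zero ×ₑ Πₑ (E ∘ suc))
  module S i = Setoid (S i)

-- Holds for every `φ`, because the representatives chosen by `Πₑ` are literally of the form
-- `∀-cons x f`.
∑ₑ-Π : {S : Fin (suc k) → Setoid a ℓ} (E : ∀ i → Enumeration (S i))
  (φ : Setoid.Carrier (Πˢ S) → ℕ) →
  ∑ₑ (Πₑ E) φ ≡ ∑ₑ (E zero) (λ x → ∑ₑ (Πₑ (E ∘ suc)) (λ f → φ (∀-cons x f)))
∑ₑ-Π E φ = ∑ₑ-× (E zero) (Πₑ (E ∘ suc)) (φ ∘ uncurry ∀-cons)

functions : ∀ n t → Enumeration (Πˢ {n} (λ _ → setoid (Fin t)))
functions n t = Πₑ (λ _ → finite t)

size-functions : ∀ n t → Enumeration.size (functions n t) ≡ t ^ n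
size-functions zero    t = refl
size-functions (suc n) t = cong (t *_) (size-functions n t)

-- Acyclic maps

-- Singles out the value at an arbitrary position: peel off the value at `zero`, recurse, and swap
-- the two sums. `φ` must respect pointwise equality because the maps built with `insertAt` and with
-- `∀-cons` agree only pointwise.
∑ₑ-insertAt : (i : Fin (suc n)) (φ : (Fin (suc n) → Fin t) → ℕ) →
  (∀ f g → f ≗ g → φ f ≡ φ g) →
  ∑ₑ (functions (suc n) t) φ ≡ ∑[ c < t ] ∑ₑ (functions n t) (λ f → φ (insertAt f i c))
∑ₑ-insertAt {n} {t} zero φ resp = trans (∑ₑ-Π (λ _ → finite t) φ)
  (sum-cong-≗ {t} λ c → ∑ₑ-cong (functions n t) λ f → resp (∀-cons c f) (insertAt f zero c) (∀-cons refl λ _ → refl))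
∑ₑ-insertAt {suc n} {t} (suc i) φ resp = begin
  ∑ₑ (functions (suc (suc n)) t) φ
    ≡⟨ ∑ₑ-Π (λ _ → finite t) φ ⟩
  ∑[ d < t ] ∑ₑ (functions (suc n) t) (λ f → φ (∀-cons d f))
    ≡⟨ (sum-cong-≗ {t} λ d → ∑ₑ-insertAt i (λ f → φ (∀-cons d f))
          λ f g f≗g → resp _ _ (∀-cons refl f≗g)) ⟩
  ∑[ d < t ] ∑[ c < t ] ∑ₑ (functions n t) (λ f → φ (∀-cons d (insertAt f i c)))
    ≡⟨ ∑-comm {t} {t} _ ⟩
  ∑[ c < t ] ∑[ d < t ] ∑ₑ (functions n t) (λ f → φ (∀-cons d (insertAt f i c)))
    ≡⟨ (sum-cong-≗ {t} λ c → sum-cong-≗ {t} λ d → ∑ₑ-cong (functions n t) λ f →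
          resp (∀-cons d (insertAt f i c)) (insertAt (∀-cons d f) (suc i) c) (∀-cons refl λ _ → refl)) ⟩
  ∑[ c < t ] ∑[ d < t ] ∑ₑ (functions n t) (λ f → φ (insertAt (∀-cons d f) (suc i) c))
    ≡⟨ (sum-cong-≗ {t} λ c → ∑ₑ-Π (λ _ → finite t) (λ f → φ (insertAt f (suc i) c))) ⟨
  ∑[ c < t ] ∑ₑ (functions (suc n) t) (λ f → φ (insertAt f (suc i) c)) ∎

sum-select : (i : Fin n) (φ : Fin n → ℕ) → ∑[ j < n ] (𝟙 (j ≟ i) * φ j) ≡ φ i
sum-select {n} i φ = begin
  ∑[ j < n ] (𝟙 (j ≟ i) * φ j) ≡⟨ sum-cong-≗ {n} select ⟩
  ∑[ j < n ] (φ i * 𝟙 (i ≟ j)) ≡⟨ *-distribˡ-sum {n} (φ i) _ ⟨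
  φ i * (∑[ j < n ] 𝟙 (i ≟ j)) ≡⟨ cong (φ i *_) (sum-≟ i) ⟩
  φ i * 1                      ≡⟨ ℕ.*-identityʳ _ ⟩
  φ i                          ∎
  where
  select : ∀ j → 𝟙 (j ≟ i) * φ j ≡ φ i * 𝟙 (i ≟ j)
  select j with i ≟ j
  ... | yes refl rewrite 𝟙-yes (i ≟ i) refl = ℕ.*-comm 1 (φ i)
  ... | no  i≢j  rewrite 𝟙-no (j ≟ i) (i≢j ∘ sym) = sym (ℕ.*-zeroʳ (φ i))

-- `zero` is the root; a map s gives the out-edges of the other vertices.
data Reaches (s : Fin y → Fin (suc y)) : Fin (suc y) → Set where
  root : Reaches s zero
  step : ∀ i → Reaches s (s i) → Reaches s (suc i)

Acyclic : (Fin y → Fin (suc y)) → Set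
Acyclic s = ∀ v → Reaches s v

Acyclic-resp : {s s′ : Fin y → Fin (suc y)} → s ≗ s′ → Acyclic s → Acyclic s′
Acyclic-resp {s = s} {s′} s≗s′ acyclic v = go (acyclic v)
  where
  go : ∀ {v} → Reaches s v → Reaches s′ v
  go root       = root
  go (step i r) = step i (subst (Reaches s′) (s≗s′ i) (go r))

-- Contracts the vertex 1 into u, where u is named after the removal of 1.
redirect : Fin (suc y) → Fin (suc (suc y)) → Fin (suc y)
redirect u = insertAt id (suc zero) u

module _ {s : Fin (suc y) → Fin (suc (suc y))} where

  -- A `Reaches` proof is a finite path, and here each step from the vertex 1 leads back to it, so
  -- the path could never end.
  loop⇒¬Acyclic : s zero ≡ suc zero → ¬ Acyclic s
  loop⇒¬Acyclic loop acyclic = go (acyclic (suc zero)) refl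
    where
    go : ∀ {v} → Reaches s v → v ≢ suc zero
    go (step zero r) refl = go r loop

  module _ (u : Fin (suc y)) (s₀ : s zero ≡ punchIn (suc zero) u) where

    -- Every path survives the contraction once its step out of the vertex 1 is deleted: both ends
    -- of that step become `u`.
    contract⁺ : Acyclic s → Acyclic (redirect u ∘ s ∘ suc)
    contract⁺ acyclic v =
      subst (Reaches _) (insertAt-punchIn id (suc zero) u v) (go (acyclic (punchIn (suc zero) v)))
      where
      go : ∀ {v} → Reaches s v → Reaches (redirect u ∘ s ∘ suc) (redirect u v)
      go root             = root
      go (step zero r)    = subst (Reaches _)
        (trans (cong (redirect u) s₀) (insertAt-punchIn id (suc zero) u u)) (go r)
      go (step (suc i) r) = step i (go r)

    -- A path of the contracted map lifts by reinserting the step from 1 to `u` wherever `s` enters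
    -- 1; `lift` does this at a single vertex.
    contract⁻ : Acyclic (redirect u ∘ s ∘ suc) → Acyclic s
    contract⁻ acyclic v = lift v (go (acyclic (redirect u v)))
      where
      reach₁ : Reaches s (punchIn (suc zero) u) → Reaches s (suc zero)
      reach₁ r = step zero (subst (Reaches s) (sym s₀) r)
      lift : ∀ v → Reaches s (punchIn (suc zero) (redirect u v)) → Reaches s v
      lift zero          r = r
      lift (suc zero)    r = reach₁ r
      lift (suc (suc i)) r = r
      go : ∀ {v} → Reaches (redirect u ∘ s ∘ suc) v → Reaches s (punchIn (suc zero) v)
      go root       = root
      go (step i r) = step (suc i) (lift (s (suc i)) (go r))

-- Contracts the vertex 1 repeatedly until only the root is left or a loop appears. The count below
-- follows the same recursion.
acyclic? : (s : Fin y → Fin (suc y)) → Dec (Acyclic s)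
acyclic? {zero}  s = yes λ { zero → root }
acyclic? {suc y} s with suc zero ≟ s zero
... | yes 1≡s₀ = no (loop⇒¬Acyclic (sym 1≡s₀))
... | no  1≢s₀ = map′ (contract⁻ _ s₀) (contract⁺ _ s₀) (acyclic? _)
  where s₀ = sym (punchIn-punchOut 1≢s₀)

-- Counting acyclic maps

fibre : (Fin t → Fin n) → Fin n → ℕ
fibre {t} ρ v = ∑[ d < t ] 𝟙 (v ≟ ρ d)

-- Each non-root vertex draws a label in `Fin t` for its out-edge, and `ρ` sends the label to its
-- target. Contracting a vertex then changes only `ρ`, while the labels of the other vertices still
-- range freely over `Fin t`.
acyclics : (Fin t → Fin (suc y)) → ℕ
acyclics {t} {y} ρ = ∑ₑ (functions y t) (λ f → 𝟙 (acyclic? (ρ ∘ f)))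

-- Splits on whether ρ c is the root, the vertex 1 sent to c (a loop), or another
-- vertex.  The second summand is on the left so that no subtraction is needed.
acyclics-∷ : (ρ : Fin t → Fin (suc (suc y))) (c : Fin t) →
  let A = fibre ρ zero; W = fibre ρ (suc zero) in
  (∀ ρ′ → t * acyclics {t} {y} ρ′ ≡ fibre ρ′ zero * t ^ y) →
  t * ∑ₑ (functions y t) (λ f → 𝟙 (acyclic? (ρ ∘ ∀-cons c f))) + A * t ^ y * 𝟙 (suc zero ≟ ρ c)
    ≡ A * t ^ y + W * t ^ y * 𝟙 (zero ≟ ρ c)
acyclics-∷ {t} {y} ρ c ih = helper (ρ c) refl
  where
  A = fibre ρ zero
  W = fibre ρ (suc zero)
  inner = ∑ₑ (functions y t) (λ f → 𝟙 (acyclic? (ρ ∘ ∀-cons c f)))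

  contracted : ∀ u → ρ c ≡ punchIn (suc zero) u →
    t * inner ≡ fibre (redirect u ∘ ρ) zero * t ^ y
  contracted u eq = trans
    (cong (t *_) (∑ₑ-cong (functions y t) λ f →
      𝟙-cong (contract⁺ u eq) (contract⁻ u eq) (acyclic? (ρ ∘ ∀-cons c f)) (acyclic? _)))
    (ih (redirect u ∘ ρ))

  -- Contracting 1 into the root redirects the `W` labels of 1 to the root. Contraction into any
  -- other vertex leaves the fibre of the root as it was (`fibre-suc`).
  fibre-zero : fibre (redirect zero ∘ ρ) zero ≡ A + W
  fibre-zero = trans
    (sum-cong-≗ {t} (λ d → pointwise (ρ d)))
    (∑-distrib-+ {t} _ _)
    where
    pointwise : ∀ v → 𝟙 (zero ≟ redirect {y} zero v) ≡ 𝟙 (zero ≟ v) + 𝟙 (suc zero ≟ v)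
    pointwise zero          = refl
    pointwise (suc zero)    = refl
    pointwise (suc (suc i)) = refl

  fibre-suc : ∀ i → fibre (redirect (suc i) ∘ ρ) zero ≡ A
  fibre-suc i = sum-cong-≗ {t} (λ d → pointwise (ρ d))
    where
    pointwise : ∀ v → 𝟙 (zero ≟ redirect {y} (suc i) v) ≡ 𝟙 (zero ≟ v)
    pointwise zero          = refl
    pointwise (suc zero)    = refl
    pointwise (suc (suc i)) = refl

  helper : ∀ v → ρ c ≡ v →
    t * inner + A * t ^ y * 𝟙 (suc zero ≟ v) ≡ A * t ^ y + W * t ^ y * 𝟙 (zero ≟ v)
  helper zero eq = begin
    t * inner + A * t ^ y * 0
      ≡⟨ cong (_+ A * t ^ y * 0) (trans (contracted zero eq) (cong (_* t ^ y) fibre-zero)) ⟩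
    (A + W) * t ^ y + A * t ^ y * 0
      ≡⟨ solve 3 (λ A W T → (A :+ W) :* T :+ A :* T :* con 0 := A :* T :+ W :* T :* con 1)
           refl A W (t ^ y) ⟩
    A * t ^ y + W * t ^ y * 1 ∎
  helper (suc zero) eq = begin
    t * inner + A * t ^ y * 1
      ≡⟨ cong (λ x → t * x + A * t ^ y * 1)
           (trans (∑ₑ-cong (functions y t) λ f → 𝟙-no (acyclic? (ρ ∘ ∀-cons c f)) (loop⇒¬Acyclic eq))
                  (trans (∑ₑ-const (functions y t) 0) (ℕ.*-zeroʳ (Enumeration.size (functions y t))))) ⟩
    t * 0 + A * t ^ y * 1
      ≡⟨ solve 3 (λ X Y t → t :* con 0 :+ X :* con 1 := X :+ Y :* con 0)
           refl (A * t ^ y) (W * t ^ y) t ⟩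
    A * t ^ y + W * t ^ y * 0 ∎
  helper (suc (suc i)) eq = begin
    t * inner + A * t ^ y * 0
      ≡⟨ cong (_+ A * t ^ y * 0) (trans (contracted (suc i) eq) (cong (_* t ^ y) (fibre-suc i))) ⟩
    A * t ^ y + A * t ^ y * 0
      ≡⟨ cong (A * t ^ y +_) (trans (ℕ.*-zeroʳ (A * t ^ y)) (sym (ℕ.*-zeroʳ (W * t ^ y)))) ⟩
    A * t ^ y + W * t ^ y * 0 ∎

-- Summed over the label `c` of the vertex 1, the loss from loops and the gain from contractions
-- into the root both come to `A * T * W` and cancel. With `ρ = id` this is Cayley's formula for
-- labelled trees.
acyclics-count : (ρ : Fin t → Fin (suc y)) → t * acyclics ρ ≡ fibre ρ zero * t ^ y
acyclics-count {t} {zero} ρ = begin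
  t * 1                       ≡⟨ sum-const t 1 ⟨
  ∑[ d < t ] 1                ≡⟨ sum-cong-≗ {t} (λ d → pointwise (ρ d)) ⟩
  ∑[ d < t ] 𝟙 (zero ≟ ρ d)   ≡⟨ ℕ.*-identityʳ _ ⟨
  fibre ρ zero * 1            ∎
  where
  pointwise : ∀ v → 1 ≡ 𝟙 (zero ≟ v)
  pointwise zero = refl
acyclics-count {t} {suc y} ρ = ℕ.+-cancelʳ-≡ (A * T * W) _ _ (begin
  t * acyclics ρ + A * T * W
    ≡⟨ cong₂ _+_ (cong (t *_) (∑ₑ-Π {k = y} (λ _ → finite t) (λ f → 𝟙 (acyclic? (ρ ∘ f))))) (*-distribˡ-sum {t} (A * T) _) ⟩
  t * (∑[ c < t ] inner c) + ∑[ c < t ] (A * T * 𝟙 (suc zero ≟ ρ c))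
    ≡⟨ cong (_+ ∑[ c < t ] (A * T * 𝟙 (suc zero ≟ ρ c))) (*-distribˡ-sum {t} t _) ⟩
  ∑[ c < t ] (t * inner c) + ∑[ c < t ] (A * T * 𝟙 (suc zero ≟ ρ c))
    ≡⟨ ∑-distrib-+ {t} _ _ ⟨
  ∑[ c < t ] (t * inner c + A * T * 𝟙 (suc zero ≟ ρ c))
    ≡⟨ sum-cong-≗ {t} (λ c → acyclics-∷ ρ c acyclics-count) ⟩
  ∑[ c < t ] (A * T + W * T * 𝟙 (zero ≟ ρ c))
    ≡⟨ ∑-distrib-+ {t} _ _ ⟩
  ∑[ c < t ] (A * T) + ∑[ c < t ] (W * T * 𝟙 (zero ≟ ρ c))
    ≡⟨ cong₂ _+_ (sum-const t _) (sym (*-distribˡ-sum {t} (W * T) _)) ⟩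
  t * (A * T) + W * T * A
    ≡⟨ solve 4 (λ t A T W → t :* (A :* T) :+ W :* T :* A := A :* (t :* T) :+ A :* T :* W) refl t A T W ⟩
  A * (t * T) + A * T * W ∎)
  where
  A = fibre ρ zero
  W = fibre ρ (suc zero)
  T = t ^ y
  inner : Fin t → ℕ
  inner c = ∑ₑ (functions y t) (λ f → 𝟙 (acyclic? (ρ ∘ ∀-cons c f)))

-- Maps that collapse to a fixed point

module _ {A : Set a} where
  open Endo A using () renaming (_^_ to _^ᶠ_) public

^ᶠ-comm : {A : Set a} (s : A → A) (r : ℕ) (x : A) → (s ^ᶠ r) (s x) ≡ s ((s ^ᶠ r) x)
^ᶠ-comm s zero    x = refl
^ᶠ-comm s (suc r) x = cong s (^ᶠ-comm s r x)

^ᶠ-fixed : {A : Set a} {s : A → A} {x : A} → s x ≡ x → ∀ r → (s ^ᶠ r) x ≡ x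
^ᶠ-fixed         fixed zero    = refl
^ᶠ-fixed {s = s} fixed (suc r) = trans (cong s (^ᶠ-fixed fixed r)) fixed

^ᶠ-stable : {A : Set a} {s : A → A} {x y : A} → s y ≡ y →
  ∀ {r r′} → r ≤′ r′ → (s ^ᶠ r) x ≡ y → (s ^ᶠ r′) x ≡ y
^ᶠ-stable         fixed ≤′-refl        eq = eq
^ᶠ-stable {s = s} fixed (≤′-step r≤r′) eq = trans (cong s (^ᶠ-stable fixed r≤r′ eq)) fixed

-- Moves x₀ to the position 0 of the root, keeping the order of the rest.
relabel : Fin (suc y) → Fin (suc y) → Fin (suc y)
relabel x₀ = insertAt suc x₀ zero

data PunchView (x₀ : Fin (suc y)) : Fin (suc y) → Set where
  ‵point  : PunchView x₀ x₀
  ‵punchIn : ∀ i → PunchView x₀ (punchIn x₀ i)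

punchView : (x₀ x : Fin (suc y)) → PunchView x₀ x
punchView x₀ x with x₀ ≟ x
... | yes refl = ‵point
... | no  x₀≢x = subst (PunchView x₀) (punchIn-punchOut x₀≢x) (‵punchIn (punchOut x₀≢x))

relabel-root : (x₀ : Fin (suc y)) → relabel x₀ x₀ ≡ zero
relabel-root x₀ = insertAt-lookup suc x₀ zero

relabel-punchIn : (x₀ : Fin (suc y)) (i : Fin y) → relabel x₀ (punchIn x₀ i) ≡ suc i
relabel-punchIn x₀ i = insertAt-punchIn suc x₀ zero i

relabel≡zero : (x₀ x : Fin (suc y)) → zero ≡ relabel x₀ x → x₀ ≡ x
relabel≡zero x₀ x eq with punchView x₀ x
... | ‵point    = refl
... | ‵punchIn i with () ← trans eq (relabel-punchIn x₀ i)

relabel≡suc : (x₀ x : Fin (suc y)) {i : Fin y} → relabel x₀ x ≡ suc i → x ≡ punchIn x₀ i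
relabel≡suc x₀ x eq with punchView x₀ x
... | ‵point    with () ← trans (sym (relabel-root x₀)) eq
... | ‵punchIn j = cong (punchIn x₀) (suc-injective (trans (sym (relabel-punchIn x₀ j)) eq))

-- Drops the edge out of `x₀` and makes `x₀` the root, so that `Acyclic` applies to what remains.
detach : Fin (suc y) → (Fin (suc y) → Fin (suc y)) → Fin y → Fin (suc y)
detach x₀ s = relabel x₀ ∘ s ∘ punchIn x₀

-- Flowing to `x₀` is expressed through `Acyclic`, which is decidable and already counted; the two
-- lemmas on iterates below give the dynamical meaning.
CollapsesTo : (Fin (suc y) → Fin (suc y)) → Fin (suc y) → Set
CollapsesTo s x₀ = x₀ ≡ s x₀ × Acyclic (detach x₀ s)

Collapses : (Fin (suc y) → Fin (suc y)) → Set
Collapses s = ∃ (CollapsesTo s)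

collapsesTo? : (s : Fin (suc y) → Fin (suc y)) → ∀ x₀ → Dec (CollapsesTo s x₀)
collapsesTo? s x₀ = (x₀ ≟ s x₀) ×-dec acyclic? (detach x₀ s)

collapses? : (s : Fin (suc y) → Fin (suc y)) → Dec (Collapses s)
collapses? s = any? (collapsesTo? s)

CollapsesTo-resp : {s s′ : Fin (suc y) → Fin (suc y)} → s ≗ s′ →
  ∀ {x₀} → CollapsesTo s x₀ → CollapsesTo s′ x₀
CollapsesTo-resp s≗s′ {x₀} (fixed , acyclic) =
  trans fixed (s≗s′ x₀) , Acyclic-resp (cong (relabel x₀) ∘ s≗s′ ∘ punchIn x₀) acyclic

Collapses-resp : {s s′ : Fin (suc y) → Fin (suc y)} → s ≗ s′ → Collapses s → Collapses s′
Collapses-resp s≗s′ = map id (CollapsesTo-resp s≗s′)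

module _ {s : Fin (suc y) → Fin (suc y)} {x₀ : Fin (suc y)} where

  -- The orbit is followed only up to its first visit to `x₀`, where the path ends at the root;
  -- hence `go` inspects `x` before `r`.
  iterates⇒CollapsesTo : s x₀ ≡ x₀ → (∀ x → ∃[ r ] (s ^ᶠ r) x ≡ x₀) → CollapsesTo s x₀
  iterates⇒CollapsesTo fixed hits = sym fixed , λ v → reaches v (punchIn′ v)
    where
    go : ∀ r x → (s ^ᶠ r) x ≡ x₀ → Reaches (detach x₀ s) (relabel x₀ x)
    go r x eq with punchView x₀ x
    go r       x eq | ‵point    = subst (Reaches _) (sym (relabel-root x₀)) root
    go zero    x eq | ‵punchIn i = contradiction eq (punchInᵢ≢i x₀ i)
    go (suc r) x eq | ‵punchIn i = subst (Reaches _) (sym (relabel-punchIn x₀ i))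
      (step i (go r (s x) (trans (^ᶠ-comm s r x) eq)))
    punchIn′ : ∀ v → ∃[ x ] relabel x₀ x ≡ v
    punchIn′ zero    = x₀ , relabel-root x₀
    punchIn′ (suc i) = punchIn x₀ i , relabel-punchIn x₀ i
    reaches : ∀ v → ∃[ x ] relabel x₀ x ≡ v → Reaches (detach x₀ s) v
    reaches v (x , refl) = uncurry (λ r → go r x) (hits x)

  CollapsesTo⇒iterates : CollapsesTo s x₀ → ∀ x → ∃[ r ] (s ^ᶠ r) x ≡ x₀
  CollapsesTo⇒iterates (fixed , acyclic) x = go x (acyclic (relabel x₀ x)) refl
    where
    go : ∀ {v} x → Reaches (detach x₀ s) v → relabel x₀ x ≡ v → ∃[ r ] (s ^ᶠ r) x ≡ x₀
    go x root eq = 0 , sym (relabel≡zero x₀ x (sym eq))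
    go x (step i p) eq with refl ← relabel≡suc x₀ x eq with r , hit ← go (s x) p refl =
      suc r , trans (sym (^ᶠ-comm s r x)) hit

-- The point `x₁` flows to `x₀`, yet as a fixed point it never moves.
CollapsesTo-unique : {s : Fin (suc y) → Fin (suc y)} {x₀ x₁ : Fin (suc y)} →
  CollapsesTo s x₀ → CollapsesTo s x₁ → x₀ ≡ x₁
CollapsesTo-unique {x₁ = x₁} collapse₀ (fixed , _) with r , eq ← CollapsesTo⇒iterates collapse₀ x₁ =
  trans (sym eq) (^ᶠ-fixed (sym fixed) r)

-- As the fixed point is unique, one may sum over it. Revealing the label `c` of its out-edge leaves
-- an acyclicity condition on the other labels, and the fibre of `ρ c` given by `acyclics-count`
-- becomes the inner sum over `j`.
collapses-count : (ρ : Fin t → Fin (suc y)) →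
  t * ∑ₑ (functions (suc y) t) (λ f → 𝟙 (collapses? (ρ ∘ f)))
    ≡ t ^ y * ∑[ i < t ] ∑[ j < t ] 𝟙 (ρ i ≟ ρ j)
collapses-count {t} {y} ρ = begin
  t * ∑ₑ (functions (suc y) t) (λ f → 𝟙 (collapses? (ρ ∘ f)))
    ≡⟨ cong (t *_) (∑ₑ-cong (functions (suc y) t) λ f →
         𝟙-any (collapsesTo? (ρ ∘ f)) CollapsesTo-unique) ⟨
  t * ∑ₑ (functions (suc y) t) (λ f → ∑[ x₀ < suc y ] 𝟙 (collapsesTo? (ρ ∘ f) x₀))
    ≡⟨ cong (t *_) (∑ₑ-sum-comm (functions (suc y) t) λ f x₀ → 𝟙 (collapsesTo? (ρ ∘ f) x₀)) ⟩
  t * ∑[ x₀ < suc y ] ∑ₑ (functions (suc y) t) (λ f → 𝟙 (collapsesTo? (ρ ∘ f) x₀))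
    ≡⟨ cong (t *_) (sum-cong-≗ {suc y} λ x₀ → trans (∑ₑ-insertAt x₀ _ (invariant x₀))
         (sum-cong-≗ {t} λ c → trans (∑ₑ-cong (functions y t) (split x₀ c))
           (∑ₑ-*ˡ (functions y t) (𝟙 (x₀ ≟ ρ c)) (λ f → 𝟙 (acyclic? (relabel x₀ ∘ ρ ∘ f)))))) ⟩
  t * ∑[ x₀ < suc y ] ∑[ c < t ] (𝟙 (x₀ ≟ ρ c) * acyclics (relabel x₀ ∘ ρ))
    ≡⟨ cong (t *_) (∑-comm {suc y} {t} λ x₀ c → 𝟙 (x₀ ≟ ρ c) * acyclics (relabel x₀ ∘ ρ)) ⟩
  t * ∑[ c < t ] ∑[ x₀ < suc y ] (𝟙 (x₀ ≟ ρ c) * acyclics (relabel x₀ ∘ ρ))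
    -- Only `x₀ = ρ c` contributes: the label determines the fixed point.
    ≡⟨ cong (t *_) (sum-cong-≗ {t} λ c → sum-select (ρ c) (λ x₀ → acyclics (relabel x₀ ∘ ρ))) ⟩
  t * ∑[ c < t ] acyclics (relabel (ρ c) ∘ ρ)
    ≡⟨ *-distribˡ-sum {t} t _ ⟩
  ∑[ c < t ] (t * acyclics (relabel (ρ c) ∘ ρ))
    ≡⟨ (sum-cong-≗ {t} λ c → trans (acyclics-count (relabel (ρ c) ∘ ρ))
         (trans (cong (_* t ^ y) (fibre-relabel (ρ c))) (ℕ.*-comm (fibre ρ (ρ c)) (t ^ y)))) ⟩
  ∑[ c < t ] (t ^ y * fibre ρ (ρ c))
    ≡⟨ *-distribˡ-sum {t} (t ^ y) _ ⟨
  t ^ y * ∑[ i < t ] ∑[ j < t ] 𝟙 (ρ i ≟ ρ j) ∎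
  where
  invariant : ∀ x₀ f g → f ≗ g → 𝟙 (collapsesTo? (ρ ∘ f) x₀) ≡ 𝟙 (collapsesTo? (ρ ∘ g) x₀)
  invariant x₀ f g f≗g = 𝟙-cong (CollapsesTo-resp (cong ρ ∘ f≗g)) (CollapsesTo-resp (cong ρ ∘ sym ∘ f≗g))
    (collapsesTo? (ρ ∘ f) x₀) (collapsesTo? (ρ ∘ g) x₀)

  split : ∀ x₀ c f →
    𝟙 (collapsesTo? (ρ ∘ insertAt f x₀ c) x₀) ≡ 𝟙 (x₀ ≟ ρ c) * 𝟙 (acyclic? (relabel x₀ ∘ ρ ∘ f))
  split x₀ c f = trans
    (𝟙-× (x₀ ≟ ρ (insertAt f x₀ c x₀)) (acyclic? (detach x₀ (ρ ∘ insertAt f x₀ c))))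
    (cong₂ _*_
      (cong (λ d → 𝟙 (x₀ ≟ ρ d)) (insertAt-lookup f x₀ c))
      (𝟙-cong
        (Acyclic-resp (λ i → cong (relabel x₀ ∘ ρ) (insertAt-punchIn f x₀ c i)))
        (Acyclic-resp (λ i → cong (relabel x₀ ∘ ρ) (sym (insertAt-punchIn f x₀ c i))))
        (acyclic? _) (acyclic? _)))

  fibre-relabel : ∀ x₀ → fibre (relabel x₀ ∘ ρ) zero ≡ fibre ρ x₀
  fibre-relabel x₀ = sum-cong-≗ {t} λ d → 𝟙-cong
    (relabel≡zero x₀ (ρ d))
    (λ { refl → sym (relabel-root x₀) })
    (zero ≟ relabel x₀ (ρ d)) (x₀ ≟ ρ d)

-- Constant powers of `H ∘ G` and collapse of `G ∘ H`

eventually-uniform : (P : Fin n → ℕ → Set) → (∀ i {r r′} → r ≤ r′ → P i r → P i r′) →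
  (∀ i → ∃ (P i)) → ∃[ r ] ∀ i → P i r
eventually-uniform {zero}  P mono holds = 0 , λ ()
eventually-uniform {suc n} P mono holds
  with r₀ , p₀ ← holds zero
     | r , p ← eventually-uniform (P ∘ suc) (mono ∘ suc) (holds ∘ suc) =
  r₀ ⊔ r , ∀-cons (mono zero (ℕ.m≤m⊔n r₀ r) p₀) (λ i → mono (suc i) (ℕ.m≤n⊔m r₀ r) (p i))

module _ {A : Set a} {u : A → A} {s : Fin (suc y) → Fin (suc y)}
  (G : A → Fin (suc y)) (H : Fin (suc y) → A) (u≗HG : u ≗ H ∘ G) (s≗GH : s ≗ G ∘ H) where

  -- The constant value `c` of `u ^ r` is fixed by `u`, since `u` commutes with its power; so `G c`
  -- is fixed by `s`. Moreover `s ^ (r + 1)` equals `G ∘ u ^ r ∘ H`, which is constantly `G c`.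
  constant-power⇒Collapses : ∃[ r ] 1 ≤ r × IsConstant (u ^ᶠ r) → Collapses s
  constant-power⇒Collapses (r , _ , c , const) = G c ,
    iterates⇒CollapsesTo {s = s}
      (trans (s≗GH (G c)) (cong G (trans (sym (u≗HG c)) u-fixed)))
      (λ v → suc r , trans (sym (shift r v)) (cong G (const (H v))))
    where
    u-fixed : u c ≡ c
    u-fixed = trans (cong u (sym (const c))) (trans (sym (^ᶠ-comm u r c)) (const (u c)))
    shift : ∀ r v → G ((u ^ᶠ r) (H v)) ≡ (s ^ᶠ suc r) v
    shift zero    v = sym (s≗GH v)
    shift (suc r) v = begin
      G (u ((u ^ᶠ r) (H v)))       ≡⟨ cong G (u≗HG _) ⟩
      G (H (G ((u ^ᶠ r) (H v))))   ≡⟨ s≗GH _ ⟨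
      s (G ((u ^ᶠ r) (H v)))       ≡⟨ cong s (shift r v) ⟩
      s ((s ^ᶠ suc r) v)           ∎

  -- Because `x₀` is fixed, the finitely many arrival times can be raised to a common `r`. Then
  -- `u ^ (r + 1)`, which is `H ∘ s ^ r ∘ G`, is constant; the extra round also makes the exponent
  -- positive.
  Collapses⇒constant-power : Collapses s → ∃[ r ] 1 ≤ r × IsConstant (u ^ᶠ r)
  Collapses⇒constant-power (x₀ , collapse)
    with r , const ← eventually-uniform (λ v r → (s ^ᶠ r) v ≡ x₀)
           (λ _ r≤r′ → ^ᶠ-stable (sym (proj₁ collapse)) (ℕ.≤⇒≤′ r≤r′)) (CollapsesTo⇒iterates collapse) =
    suc r , s≤s z≤n , H x₀ , λ x → trans (sym (shift r x)) (cong H (const (G x)))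
    where
    shift : ∀ r x → H ((s ^ᶠ r) (G x)) ≡ (u ^ᶠ suc r) x
    shift zero    x = sym (u≗HG x)
    shift (suc r) x = begin
      H (s ((s ^ᶠ r) (G x)))       ≡⟨ cong H (s≗GH _) ⟩
      H (G (H ((s ^ᶠ r) (G x))))   ≡⟨ u≗HG _ ⟨
      u (H ((s ^ᶠ r) (G x)))       ≡⟨ cong u (shift r x) ⟩
      u ((u ^ᶠ suc r) x)           ∎

-- Maps that keep two points apart

sum-≢ : (d : Fin t) → ∑[ c < t ] 𝟙 (¬? (d ≟ c)) ≡ t ∸ 1
sum-≢ {t} d = begin
  ∑[ c < t ] 𝟙 (¬? (d ≟ c))
    ≡⟨ ℕ.m+n∸m≡n 1 _ ⟨
  1 + (∑[ c < t ] 𝟙 (¬? (d ≟ c))) ∸ 1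
    ≡⟨ cong (λ x → x + (∑[ c < t ] 𝟙 (¬? (d ≟ c))) ∸ 1) (sum-≟ d) ⟨
  (∑[ c < t ] 𝟙 (d ≟ c)) + (∑[ c < t ] 𝟙 (¬? (d ≟ c))) ∸ 1
    ≡⟨ cong (_∸ 1) (∑-distrib-+ {t} (λ c → 𝟙 (d ≟ c)) (λ c → 𝟙 (¬? (d ≟ c)))) ⟨
  (∑[ c < t ] (𝟙 (d ≟ c) + 𝟙 (¬? (d ≟ c)))) ∸ 1
    ≡⟨ cong (_∸ 1) (sum-cong-≗ {t} (λ c → 𝟙-¬ (d ≟ c))) ⟩
  (∑[ c < t ] 1) ∸ 1
    ≡⟨ cong (_∸ 1) (trans (sum-const t 1) (ℕ.*-identityʳ t)) ⟩
  t ∸ 1 ∎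

-- For distinct points the value at `i` is chosen after all others, and `t ∸ 1` of its `t` possible
-- values avoid `f j`. The factor `t` on the left clears the denominator of the probability
-- `(t - 1) / t`.
separating-functions : (i j : Fin n) →
  t * ∑ₑ (functions n t) (λ f → 𝟙 (¬? (f i ≟ f j)))
    ≡ t ^ n * (t ∸ 1) * 𝟙 (¬? (i ≟ j))
separating-functions {suc n} {t} i j with punchView i j
... | ‵point = begin
  t * ∑ₑ F (λ f → 𝟙 (¬? (f i ≟ f i)))
    ≡⟨ cong (t *_) (trans (∑ₑ-cong F λ f → 𝟙-no (¬? (f i ≟ f i)) (λ ≢ → ≢ refl))
         (trans (∑ₑ-const F 0) (ℕ.*-zeroʳ (Enumeration.size F)))) ⟩
  t * 0
    ≡⟨ trans (ℕ.*-zeroʳ t) (sym (ℕ.*-zeroʳ (t ^ suc n * (t ∸ 1)))) ⟩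
  t ^ suc n * (t ∸ 1) * 0
    ≡⟨ cong (t ^ suc n * (t ∸ 1) *_) (𝟙-no (¬? (i ≟ i)) (λ ≢ → ≢ refl)) ⟨
  t ^ suc n * (t ∸ 1) * 𝟙 (¬? (i ≟ i)) ∎
  where F = functions (suc n) t
... | ‵punchIn k = begin
  t * ∑ₑ (functions (suc n) t) (λ f → 𝟙 (¬? (f i ≟ f (punchIn i k))))
    ≡⟨ cong (t *_) (∑ₑ-insertAt {t = t} i (λ f → 𝟙 (¬? (f i ≟ f (punchIn i k))))
         λ f g f≗g → cong₂ (λ c d → 𝟙 (¬? (c ≟ d))) (f≗g i) (f≗g (punchIn i k))) ⟩
  t * ∑[ c < t ] ∑ₑ F (λ f → 𝟙 (¬? (insertAt f i c i ≟ insertAt f i c (punchIn i k))))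
    ≡⟨ cong (t *_) (sum-cong-≗ {t} λ c → ∑ₑ-cong F λ f → trans
         (cong₂ (λ c d → 𝟙 (¬? (c ≟ d))) (insertAt-lookup f i c) (insertAt-punchIn f i c k))
         (𝟙-cong (_∘ sym) (_∘ sym) (¬? (c ≟ f k)) (¬? (f k ≟ c)))) ⟩
  t * ∑[ c < t ] ∑ₑ F (λ f → 𝟙 (¬? (f k ≟ c)))
    ≡⟨ cong (t *_) (∑ₑ-sum-comm F λ f c → 𝟙 (¬? (f k ≟ c))) ⟨
  t * ∑ₑ F (λ f → ∑[ c < t ] 𝟙 (¬? (f k ≟ c)))
    ≡⟨ cong (t *_) (∑ₑ-cong F λ f → sum-≢ (f k)) ⟩
  t * ∑ₑ F (λ _ → t ∸ 1)
    ≡⟨ cong (t *_) (trans (∑ₑ-const F (t ∸ 1)) (cong (_* (t ∸ 1)) (size-functions n t))) ⟩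
  t * (t ^ n * (t ∸ 1))
    ≡⟨ trans (sym (ℕ.*-assoc t (t ^ n) (t ∸ 1))) (sym (ℕ.*-identityʳ _)) ⟩
  t ^ suc n * (t ∸ 1) * 1
    ≡⟨ cong (t ^ suc n * (t ∸ 1) *_) (𝟙-yes (¬? (i ≟ punchIn i k)) (punchInᵢ≢i i k ∘ sym)) ⟨
  t ^ suc n * (t ∸ 1) * 𝟙 (¬? (i ≟ punchIn i k)) ∎
  where F = functions n t

-- Chains of functions

∏-cong : {f g : Fin k → ℕ} → f ≗ g → ∏ f ≡ ∏ g
∏-cong {zero}  f≗g = refl
∏-cong {suc k} f≗g = cong₂ _*_ (f≗g zero) (∏-cong (f≗g ∘ suc))

∏-distrib-* : (f g : Fin k → ℕ) → ∏ (λ i → f i * g i) ≡ ∏ f * ∏ g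
∏-distrib-* {zero}  f g = refl
∏-distrib-* {suc k} f g = begin
  f zero * g zero * ∏ (λ i → f (suc i) * g (suc i))
    ≡⟨ cong (f zero * g zero *_) (∏-distrib-* (f ∘ suc) (g ∘ suc)) ⟩
  f zero * g zero * (∏ (f ∘ suc) * ∏ (g ∘ suc))
    ≡⟨ ℕ.[m*n]*[o*p]≡[m*o]*[n*p] (f zero) (g zero) _ _ ⟩
  ∏ f * ∏ g ∎

∏-suc-nonZero : (p : Fin k → ℕ) → NonZero (∏ (suc ∘ p))
∏-suc-nonZero {zero}  p = _
∏-suc-nonZero {suc k} p = ℕ.m*n≢0 (suc (p zero)) (∏ (suc ∘ p ∘ suc))
  where instance _ = ∏-suc-nonZero (p ∘ suc)

Steps : (Fin (suc m) → ℕ) → Setoid _ _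
Steps {m} ν = Πˢ {m} (λ j → Πˢ {ν (inject₁ j)} (λ _ → setoid (Fin (ν (suc j)))))

steps : (ν : Fin (suc m) → ℕ) → Enumeration (Steps ν)
steps ν = Πₑ (λ j → functions (ν (inject₁ j)) (ν (suc j)))

#steps : (Fin (suc m) → ℕ) → ℕ
#steps ν = ∏ (λ j → ν (suc j) ^ ν (inject₁ j))

size-steps : (ν : Fin (suc m) → ℕ) → Enumeration.size (steps ν) ≡ #steps ν
size-steps {zero}  ν = refl
size-steps {suc m} ν = cong₂ _*_ (size-functions (ν zero) (ν (suc zero))) (size-steps (ν ∘ suc))

-- Used in two ways: with identities for `φ` it says that `chain` respects pointwise equality of the
-- steps, and with bijections it transports chains from the `X i` to standard finite sets.
chain-natural : {X : Fin (suc m) → Set a} {Y : Fin (suc m) → Set b} (φ : ∀ i → X i → Y i)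
  (f : ∀ j → X (inject₁ j) → X (suc j)) (g : ∀ j → Y (inject₁ j) → Y (suc j)) →
  (∀ j x → φ (suc j) (f j x) ≡ g j (φ (inject₁ j) x)) →
  ∀ x → φ (fromℕ m) (chain X f x) ≡ chain Y g (φ zero x)
chain-natural {m = zero}          φ f g comm x = refl
chain-natural {m = suc m} {Y = Y} φ f g comm x = trans
  (chain-natural (φ ∘ suc) (f ∘ suc) (g ∘ suc) (comm ∘ suc) (f zero x))
  (cong (chain (Y ∘ suc) (g ∘ suc)) (comm zero x))

-- By induction, with the remaining chain applied to the images `f i` and `f j` under the first map.
-- The indicator on the right covers the case where these already coincide, and what is left to sum
-- over `f` is `separating-functions`.
separating-chains : (ν : Fin (suc m) → ℕ) (i j : Fin (ν zero)) →
  ∏ (ν ∘ suc) * ∑ₑ (steps ν) (λ g → 𝟙 (¬? (chain (Fin ∘ ν) g i ≟ chain (Fin ∘ ν) g j)))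
    ≡ #steps ν * ∏ (λ j → ν (suc j) ∸ 1) * 𝟙 (¬? (i ≟ j))
separating-chains {zero} ν i j = ℕ.+-identityʳ _
separating-chains {suc m} ν i j = begin
  ν₁ * M * ∑ₑ (steps ν) (λ g → 𝟙 (¬? (chain (Fin ∘ ν) g i ≟ chain (Fin ∘ ν) g j)))
    ≡⟨ cong (ν₁ * M *_) (∑ₑ-Π {k = m} (λ j → functions (ν (inject₁ j)) (ν (suc j)))
         (λ g → 𝟙 (¬? (chain (Fin ∘ ν) g i ≟ chain (Fin ∘ ν) g j)))) ⟩
  ν₁ * M * ∑ₑ F (λ f → rest (f i) (f j))
    ≡⟨ ℕ.*-assoc ν₁ M _ ⟩
  ν₁ * (M * ∑ₑ F (λ f → rest (f i) (f j)))
    ≡⟨ cong (ν₁ *_) (∑ₑ-*ˡ F M (λ f → rest (f i) (f j))) ⟨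
  ν₁ * ∑ₑ F (λ f → M * rest (f i) (f j))
    ≡⟨ cong (ν₁ *_) (∑ₑ-cong F λ f → separating-chains (ν ∘ suc) (f i) (f j)) ⟩
  ν₁ * ∑ₑ F (λ f → G * P * 𝟙 (¬? (f i ≟ f j)))
    ≡⟨ cong (ν₁ *_) (∑ₑ-*ˡ F (G * P) (λ f → 𝟙 (¬? (f i ≟ f j)))) ⟩
  ν₁ * (G * P * ∑ₑ F (λ f → 𝟙 (¬? (f i ≟ f j))))
    ≡⟨ solve 3 (λ ν GP S → ν :* (GP :* S) := GP :* (ν :* S)) refl ν₁ (G * P) _ ⟩
  G * P * (ν₁ * ∑ₑ F (λ f → 𝟙 (¬? (f i ≟ f j))))
    ≡⟨ cong (G * P *_) (separating-functions i j) ⟩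
  G * P * (ν₁ ^ ν zero * (ν₁ ∸ 1) * 𝟙 (¬? (i ≟ j)))
    ≡⟨ solve 5 (λ G P T p₁ I → G :* P :* (T :* p₁ :* I) := T :* G :* (p₁ :* P) :* I) refl
         G P (ν₁ ^ ν zero) (ν₁ ∸ 1) _ ⟩
  ν₁ ^ ν zero * G * ((ν₁ ∸ 1) * P) * 𝟙 (¬? (i ≟ j)) ∎
  where
  ν₁ = ν (suc zero)
  M = ∏ (λ j → ν (suc (suc j)))
  P = ∏ (λ j → ν (suc (suc j)) ∸ 1)
  G = #steps (ν ∘ suc)
  F = functions (ν zero) ν₁
  rest : Fin ν₁ → Fin ν₁ → ℕ
  rest u v = ∑ₑ (steps (ν ∘ suc)) (λ g →
    𝟙 (¬? (chain (Fin ∘ ν ∘ suc) g u ≟ chain (Fin ∘ ν ∘ suc) g v)))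

module _ (ν : Fin (suc m) → ℕ) where
  private
    p : Fin (suc m) → ℕ
    p j = ν j ∸ 1
    n₀ M G : ℕ
    n₀ = ν zero
    M = ∏ (ν ∘ suc)
    G = #steps ν
    end : Setoid.Carrier (Steps ν) → Fin n₀ → Fin (ν (fromℕ m))
    end = chain (Fin ∘ ν)

  -- Counts the complement. The pairs kept apart contribute `∏ p`: its factor at `zero` counts the
  -- points `j` distinct from a given `i`, the others come from the chain. In the same way one of
  -- the two factors `n₀` for all pairs completes `M` to `∏ ν`.
  coalescing-chains :
    M * ∑ₑ (steps ν) (λ g → ∑[ i < n₀ ] ∑[ j < n₀ ] 𝟙 (end g i ≟ end g j))
      ≡ G * n₀ * (∏ ν ∸ ∏ p)
  coalescing-chains = begin
    M * E                                 ≡⟨ ℕ.m+n∸n≡m (M * E) (M * D) ⟨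
    M * E + M * D ∸ M * D                 ≡⟨ cong₂ _∸_ total M*D ⟩
    G * n₀ * ∏ ν ∸ G * n₀ * ∏ p           ≡⟨ ℕ.*-distribˡ-∸ (G * n₀) (∏ ν) (∏ p) ⟨
    G * n₀ * (∏ ν ∸ ∏ p)                  ∎
    where
    S = steps ν
    same diff : Setoid.Carrier (Steps ν) → Fin n₀ → Fin n₀ → ℕ
    same g i j = 𝟙 (end g i ≟ end g j)
    diff g i j = 𝟙 (¬? (end g i ≟ end g j))
    E = ∑ₑ S (λ g → ∑[ i < n₀ ] ∑[ j < n₀ ] same g i j)
    D = ∑ₑ S (λ g → ∑[ i < n₀ ] ∑[ j < n₀ ] diff g i j)

    pairs : ∀ g → (∑[ i < n₀ ] ∑[ j < n₀ ] same g i j) + (∑[ i < n₀ ] ∑[ j < n₀ ] diff g i j) ≡ n₀ * n₀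
    pairs g = begin
      (∑[ i < n₀ ] ∑[ j < n₀ ] same g i j) + (∑[ i < n₀ ] ∑[ j < n₀ ] diff g i j)
        ≡⟨ ∑-distrib-+ {n₀} (λ i → ∑[ j < n₀ ] same g i j) (λ i → ∑[ j < n₀ ] diff g i j) ⟨
      ∑[ i < n₀ ] ((∑[ j < n₀ ] same g i j) + ∑[ j < n₀ ] diff g i j)
        ≡⟨ (sum-cong-≗ {n₀} λ i → trans
             (sym (∑-distrib-+ {n₀} (same g i) (diff g i)))
             (trans (sum-cong-≗ {n₀} λ j → 𝟙-¬ (end g i ≟ end g j))
               (trans (sum-const n₀ 1) (ℕ.*-identityʳ n₀)))) ⟩
      ∑[ i < n₀ ] n₀
        ≡⟨ sum-const n₀ n₀ ⟩
      n₀ * n₀ ∎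

    total : M * E + M * D ≡ G * n₀ * ∏ ν
    total = begin
      M * E + M * D       ≡⟨ ℕ.*-distribˡ-+ M E D ⟨
      M * (E + D)         ≡⟨ cong (M *_) (∑ₑ-+ S
                               (λ g → ∑[ i < n₀ ] ∑[ j < n₀ ] same g i j)
                               (λ g → ∑[ i < n₀ ] ∑[ j < n₀ ] diff g i j)) ⟨
      M * ∑ₑ S (λ g → (∑[ i < n₀ ] ∑[ j < n₀ ] same g i j) + ∑[ i < n₀ ] ∑[ j < n₀ ] diff g i j)
                          ≡⟨ cong (M *_) (trans (∑ₑ-cong S pairs) (∑ₑ-const S (n₀ * n₀))) ⟩
      M * (Enumeration.size S * (n₀ * n₀))
                          ≡⟨ cong (λ s → M * (s * (n₀ * n₀))) (size-steps ν) ⟩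
      M * (G * (n₀ * n₀)) ≡⟨ solve 3 (λ M G ν → M :* (G :* (ν :* ν)) := G :* ν :* (ν :* M)) refl M G n₀ ⟩
      G * n₀ * ∏ ν        ∎

    M*D : M * D ≡ G * n₀ * ∏ p
    M*D = begin
      M * D
        ≡⟨ cong (M *_) (trans (∑ₑ-sum-comm S (λ g i → ∑[ j < n₀ ] diff g i j))
             (sum-cong-≗ {n₀} λ i → ∑ₑ-sum-comm S (λ g → diff g i))) ⟩
      M * ∑[ i < n₀ ] ∑[ j < n₀ ] ∑ₑ S (λ g → diff g i j)
        ≡⟨ trans (*-distribˡ-sum {n₀} M _) (sum-cong-≗ {n₀} λ i → *-distribˡ-sum {n₀} M _) ⟩
      ∑[ i < n₀ ] ∑[ j < n₀ ] (M * ∑ₑ S (λ g → diff g i j))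
        ≡⟨ (sum-cong-≗ {n₀} λ i → trans (sum-cong-≗ {n₀} (separating-chains ν i))
             (trans (sym (*-distribˡ-sum {n₀} (G * ∏ (p ∘ suc)) (λ j → 𝟙 (¬? (i ≟ j)))))
               (cong (G * ∏ (p ∘ suc) *_) (sum-≢ i)))) ⟩
      ∑[ i < n₀ ] (G * ∏ (p ∘ suc) * p zero)
        ≡⟨ sum-const n₀ _ ⟩
      n₀ * (G * ∏ (p ∘ suc) * p zero)
        ≡⟨ solve 4 (λ ν G P p₀ → ν :* (G :* P :* p₀) := G :* ν :* (p₀ :* P)) refl
             n₀ G (∏ (p ∘ suc)) (p zero) ⟩
      G * n₀ * ∏ p ∎

-- Combining the two counts

collapsing-pairs-count : {S : Setoid a ℓ} (E : Enumeration S)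
  (ρ : Setoid.Carrier S → Fin t → Fin (suc y)) →
  t * ∑ₑ (E ×ₑ functions (suc y) t) (λ gh → 𝟙 (collapses? (ρ (proj₁ gh) ∘ proj₂ gh)))
    ≡ t ^ y * ∑ₑ E (λ g → ∑[ i < t ] ∑[ j < t ] 𝟙 (ρ g i ≟ ρ g j))
collapsing-pairs-count {t = t} {y} E ρ = begin
  t * ∑ₑ (E ×ₑ H) (λ gh → 𝟙 (collapses? (ρ (proj₁ gh) ∘ proj₂ gh)))
    ≡⟨ cong (t *_) (∑ₑ-× E H (λ gh → 𝟙 (collapses? (ρ (proj₁ gh) ∘ proj₂ gh)))) ⟩
  t * ∑ₑ E (λ g → ∑ₑ H (λ h → 𝟙 (collapses? (ρ g ∘ h))))
    ≡⟨ ∑ₑ-*ˡ E t (λ g → ∑ₑ H (λ h → 𝟙 (collapses? (ρ g ∘ h)))) ⟨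
  ∑ₑ E (λ g → t * ∑ₑ H (λ h → 𝟙 (collapses? (ρ g ∘ h))))
    ≡⟨ ∑ₑ-cong E (λ g → collapses-count (ρ g)) ⟩
  ∑ₑ E (λ g → t ^ y * ∑[ i < t ] ∑[ j < t ] 𝟙 (ρ g i ≟ ρ g j))
    ≡⟨ ∑ₑ-*ˡ E (t ^ y) (λ g → ∑[ i < t ] ∑[ j < t ] 𝟙 (ρ g i ≟ ρ g j)) ⟩
  t ^ y * ∑ₑ E (λ g → ∑[ i < t ] ∑[ j < t ] 𝟙 (ρ g i ≟ ρ g j)) ∎
  where H = functions (suc y) t

-- Here n = n₁, M = ∏ nᵢ over i ≥ 2, N = n₁ ^ (nₖ - 1), C is the number of pairs
-- (g , h), E that of triples (g , i , j) with g i = g j, and G that of all g.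
eliminate : ∀ n M C N E G G′ Δ → NonZero (n * M) →
  n * C ≡ N * E → M * E ≡ G * n * Δ → G ≡ M * G′ → C ≡ N * G′ * Δ
eliminate n M C N E G G′ Δ nonZero nC ME refl = ℕ.*-cancelˡ-≡ C (N * G′ * Δ) (n * M) (begin
  n * M * C             ≡⟨ solve 3 (λ n M C → n :* M :* C := M :* (n :* C)) refl n M C ⟩
  M * (n * C)           ≡⟨ cong (M *_) nC ⟩
  M * (N * E)           ≡⟨ solve 3 (λ M N E → M :* (N :* E) := N :* (M :* E)) refl M N E ⟩
  N * (M * E)           ≡⟨ cong (N *_) ME ⟩
  N * (M * G′ * n * Δ)  ≡⟨ solve 5 (λ N M G n Δ → N :* (M :* G :* n :* Δ) := n :* M :* (N :* G :* Δ)) refl N M G′ n Δ ⟩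
  n * M * (N * G′ * Δ)  ∎)
  where instance _ = nonZero

-- Splitting a tuple into its first m functions and the last one

Split : (Fin (suc m) → ℕ) → Setoid _ _
Split {m} ν = ×-setoid (Steps ν) (Πˢ {ν (fromℕ m)} (λ _ → setoid (Fin (ν zero))))

splits : (ν : Fin (suc m) → ℕ) → Enumeration (Split ν)
splits {m} ν = steps ν ×ₑ functions (ν (fromℕ m)) (ν zero)

module _ (p : Fin (suc m) → ℕ) where
  private
    ν : Fin (suc m) → ℕ
    ν = suc ∘ p
    module Split = Setoid (Split ν)
    end : Setoid.Carrier (Steps ν) → Fin (ν zero) → Fin (ν (fromℕ m))
    end = chain (Fin ∘ ν)

  Collapsing : Split.Carrier → Set
  Collapsing gh = Collapses (end (proj₁ gh) ∘ proj₂ gh)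

  collapsing? : ∀ gh → Dec (Collapsing gh)
  collapsing? gh = collapses? (end (proj₁ gh) ∘ proj₂ gh)

  Collapsing-resp : ∀ {gh gh′} → gh Split.≈ gh′ → Collapsing gh → Collapsing gh′
  Collapsing-resp {g , h} {g′ , h′} (g≈g′ , h≈h′) = Collapses-resp λ x → trans
    (chain-natural (λ _ → id) g g′ g≈g′ (h x))
    (cong (end g′) (h≈h′ x))

  private
    C E : ℕ
    C = ∑ₑ (splits ν) (λ gh → 𝟙 (collapsing? gh))
    E = ∑ₑ (steps ν) (λ g → ∑[ i < ν zero ] ∑[ j < ν zero ] 𝟙 (end g i ≟ end g j))

  collapsing-count : C ≡ ∏ (λ i → ν i ^ p (prev i)) * (∏ ν ∸ ∏ p)
  collapsing-count = eliminate
    (ν zero) (∏ (ν ∘ suc)) C (ν zero ^ p (fromℕ m)) E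
    -- As `prev` computes on `zero` and on `suc j`, this product times `ν zero ^ p (fromℕ m)` is by
    -- definition the product over the whole cycle.
    (#steps ν) (∏ (λ j → ν (suc j) ^ p (inject₁ j))) (∏ ν ∸ ∏ p)
    (∏-suc-nonZero p)
    (collapsing-pairs-count (steps ν) end)
    (coalescing-chains ν)
    -- Since `ν` is `suc ∘ p`, each power in `#steps ν` unfolds to one factor `ν (suc j)` times the
    -- power with exponent `p (inject₁ j)`.
    (∏-distrib-* (ν ∘ suc) (λ j → ν (suc j) ^ p (inject₁ j)))

  Collapsing-cardinality : HasCardinality (Subsetoid (Split ν) Collapsing)
    (∏ (λ i → ν i ^ p (prev i)) * (∏ ν ∸ ∏ p))
  Collapsing-cardinality = subst (HasCardinality (Subsetoid (Split ν) Collapsing)) collapsing-count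
    (subsetoid-cardinality (splits ν) collapsing? (λ {gh} {gh′} → Collapsing-resp {gh} {gh′}))

-- Transport of tuples from the sets `X i` to `Fin (ν i)`

module _ {X : Fin (suc m) → Set a} {ν : Fin (suc m) → ℕ}
  (card : ∀ i → HasCardinality (setoid (X i)) (ν i)) where
  private
    module C i = Inverse (card i)
    module Split = Setoid (Split ν)

    forward : Tuple X → ∀ j → X (inject₁ j) → X (suc j)
    forward f j = subst X (next-inject₁ j) ∘ f (inject₁ j)

    return : Tuple X → X (fromℕ m) → X zero
    return f = subst X (next-fromℕ m) ∘ f (fromℕ m)

  split : Tuple X → Split.Carrier
  split f = (λ j → C.to (suc j) ∘ forward f j ∘ C.from (inject₁ j))
          , (C.to zero ∘ return f ∘ C.from (fromℕ m))

  private
    -- The view is an explicit argument so that proofs can match on it, or replace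
    -- `view (inject₁ j)` by `‵inject₁ j` along `view-inject₁`.
    unsplit-view : Split.Carrier → ∀ {i} → View i → X i → X (next i)
    unsplit-view (g , h) ‵fromℕ       = subst X (sym (next-fromℕ m)) ∘ C.from zero ∘ h ∘ C.to (fromℕ m)
    unsplit-view (g , h) (‵inject₁ j) = subst X (sym (next-inject₁ j)) ∘ C.from (suc j) ∘ g j ∘ C.to (inject₁ j)

  unsplit : Split.Carrier → Tuple X
  unsplit gh i = unsplit-view gh (view i)

  split-unsplit : ∀ gh → split (unsplit gh) Split.≈ gh
  split-unsplit gh@(g , h) =
    (λ j x → begin
      C.to (suc j) (subst X (next-inject₁ j) (unsplit gh (inject₁ j) (C.from (inject₁ j) x)))
        ≡⟨ cong (λ v → C.to (suc j) (subst X (next-inject₁ j) (unsplit-view gh v (C.from (inject₁ j) x))))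
             (view-inject₁ j) ⟩
      C.to (suc j) (subst X (next-inject₁ j) (subst X (sym (next-inject₁ j)) (C.from (suc j) (g j _))))
        ≡⟨ cong (C.to (suc j)) (subst-subst-sym (next-inject₁ j)) ⟩
      C.to (suc j) (C.from (suc j) (g j (C.to (inject₁ j) (C.from (inject₁ j) x))))
        ≡⟨ C.strictlyInverseˡ (suc j) _ ⟩
      g j (C.to (inject₁ j) (C.from (inject₁ j) x))
        ≡⟨ cong (g j) (C.strictlyInverseˡ (inject₁ j) x) ⟩
      g j x ∎) ,
    (λ x → begin
      C.to zero (subst X (next-fromℕ m) (unsplit gh (fromℕ m) (C.from (fromℕ m) x)))
        ≡⟨ cong (λ v → C.to zero (subst X (next-fromℕ m) (unsplit-view gh v (C.from (fromℕ m) x))))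
             (view-fromℕ m) ⟩
      C.to zero (subst X (next-fromℕ m) (subst X (sym (next-fromℕ m)) (C.from zero (h _))))
        ≡⟨ cong (C.to zero) (subst-subst-sym (next-fromℕ m)) ⟩
      C.to zero (C.from zero (h (C.to (fromℕ m) (C.from (fromℕ m) x))))
        ≡⟨ C.strictlyInverseˡ zero _ ⟩
      h (C.to (fromℕ m) (C.from (fromℕ m) x))
        ≡⟨ cong h (C.strictlyInverseˡ (fromℕ m) x) ⟩
      h x ∎)

  unsplit-split : ∀ f {i} (v : View i) x → unsplit-view (split f) v x ≡ f i x
  unsplit-split f ‵fromℕ x = begin
    subst X (sym (next-fromℕ m)) (C.from zero (C.to zero (return f (C.from (fromℕ m) (C.to (fromℕ m) x)))))
      ≡⟨ cong (subst X (sym (next-fromℕ m))) (C.strictlyInverseʳ zero _) ⟩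
    subst X (sym (next-fromℕ m)) (return f (C.from (fromℕ m) (C.to (fromℕ m) x)))
      ≡⟨ subst-sym-subst (next-fromℕ m) ⟩
    f (fromℕ m) (C.from (fromℕ m) (C.to (fromℕ m) x))
      ≡⟨ cong (f (fromℕ m)) (C.strictlyInverseʳ (fromℕ m) x) ⟩
    f (fromℕ m) x ∎
  unsplit-split f (‵inject₁ j) x = begin
    subst X (sym (next-inject₁ j))
        (C.from (suc j) (C.to (suc j) (forward f j (C.from (inject₁ j) (C.to (inject₁ j) x)))))
      ≡⟨ cong (subst X (sym (next-inject₁ j))) (C.strictlyInverseʳ (suc j) _) ⟩
    subst X (sym (next-inject₁ j)) (forward f j (C.from (inject₁ j) (C.to (inject₁ j) x)))
      ≡⟨ subst-sym-subst (next-inject₁ j) ⟩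
    f (inject₁ j) (C.from (inject₁ j) (C.to (inject₁ j) x))
      ≡⟨ cong (f (inject₁ j)) (C.strictlyInverseʳ (inject₁ j) x) ⟩
    f (inject₁ j) x ∎

  split-inverse : Inverse (tupleSetoid X) (Split ν)
  split-inverse = mkInverse (tupleSetoid X) (Split ν) split unsplit
    (λ f≈f′ → (λ j x → cong (C.to (suc j) ∘ subst X (next-inject₁ j)) (f≈f′ (inject₁ j) _))
            , (λ x → cong (C.to zero ∘ subst X (next-fromℕ m)) (f≈f′ (fromℕ m) _)))
    (λ {gh} {gh′} gh≈gh′ i x → unsplit-cong gh gh′ gh≈gh′ (view i) x)
    split-unsplit (λ f i x → unsplit-split f (view i) x)
    where
    unsplit-cong : ∀ gh gh′ → gh Split.≈ gh′ → ∀ {i} (v : View i) x →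
      unsplit-view gh v x ≡ unsplit-view gh′ v x
    unsplit-cong gh gh′ (g≈g′ , h≈h′) ‵fromℕ x =
      cong (subst X (sym (next-fromℕ m)) ∘ C.from zero) (h≈h′ _)
    unsplit-cong gh gh′ (g≈g′ , h≈h′) (‵inject₁ j) x =
      cong (subst X (sym (next-inject₁ j)) ∘ C.from (suc j)) (g≈g′ j _)

  chain-split : ∀ f x → C.to (fromℕ m) (chain X (forward f) x) ≡ chain (Fin ∘ ν) (proj₁ (split f)) (C.to zero x)
  chain-split f = chain-natural C.to (forward f) (proj₁ (split f))
    (λ j x → cong (C.to (suc j) ∘ forward f j) (sym (C.strictlyInverseʳ (inject₁ j) x)))

  composite-split : ∀ f → composite X f ≗
    C.from zero ∘ proj₂ (split f) ∘ chain (Fin ∘ ν) (proj₁ (split f)) ∘ C.to zero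
  composite-split f x = begin
    return f (chain X (forward f) x)
      ≡⟨ cong (return f) (C.strictlyInverseʳ (fromℕ m) _) ⟨
    return f (C.from (fromℕ m) (C.to (fromℕ m) (chain X (forward f) x)))
      ≡⟨ C.strictlyInverseʳ zero _ ⟨
    C.from zero (proj₂ (split f) (C.to (fromℕ m) (chain X (forward f) x)))
      ≡⟨ cong (C.from zero ∘ proj₂ (split f)) (chain-split f x) ⟩
    C.from zero (proj₂ (split f) (chain (Fin ∘ ν) (proj₁ (split f)) (C.to zero x))) ∎

-- The cardinality of `EC`

module _ (X : Fin (suc m) → Set a) (p : Fin (suc m) → ℕ)
  (card : ∀ i → HasCardinality (setoid (X i)) (suc (p i))) where
  private
    ν : Fin (suc m) → ℕ
    ν = suc ∘ p
    module C₀ = Inverse (card zero)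
    G : Tuple X → X zero → Fin (ν (fromℕ m))
    G f = chain (Fin ∘ ν) (proj₁ (split card f)) ∘ C₀.to
    H : Tuple X → Fin (ν (fromℕ m)) → X zero
    H f = C₀.from ∘ proj₂ (split card f)
    GH : ∀ f → chain (Fin ∘ ν) (proj₁ (split card f)) ∘ proj₂ (split card f) ≗ G f ∘ H f
    GH f x = cong (chain (Fin ∘ ν) (proj₁ (split card f))) (sym (C₀.strictlyInverseˡ _))

  EventuallyConstant⇒Collapsing : ∀ f → EventuallyConstant X f → Collapsing p (split card f)
  EventuallyConstant⇒Collapsing f =
    constant-power⇒Collapses (G f) (H f) (composite-split card f) (GH f)

  Collapsing⇒EventuallyConstant : ∀ gh → Collapsing p gh → EventuallyConstant X (unsplit card gh)
  Collapsing⇒EventuallyConstant gh collapsing =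
    Collapses⇒constant-power (G f) (H f) (composite-split card f) (GH f)
      (Collapsing-resp p {gh} {split card f}
        (Setoid.sym (Split ν) {split card f} {gh} (split-unsplit card gh)) collapsing)
    where f = unsplit card gh

  EC-inverse : Inverse (EC X) (Subsetoid (Split ν) (Collapsing p))
  EC-inverse = Subsetoid-inverse (split-inverse card)
    (λ {f} → EventuallyConstant⇒Collapsing f) (λ {gh} → Collapsing⇒EventuallyConstant gh)

  EC-cardinality : HasCardinality (EC X) (∏ (λ i → ν i ^ p (prev i)) * (∏ ν ∸ ∏ p))
  EC-cardinality = Compose.inverse EC-inverse (Collapsing-cardinality p)

proposition1p2 : ∀ {a} (m : ℕ) (X : Fin (suc m) → Set a) (n : Fin (suc m) → ℕ) →
    (∀ i → X i) →
    (∀ i → HasCardinality (setoid (X i)) (n i)) →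
    HasCardinality (EC X)
    (∏ (λ i → n i ^ (n (prev i) ∸ 1)) * (∏ n ∸ ∏ (λ j → n j ∸ 1)))
proposition1p2 m X n inhabited card = subst (HasCardinality (EC X))
  (cong₂ (λ A B → A * (B ∸ ∏ p))
    (∏-cong λ i → cong (_^ p (prev i)) (sym (n≡1+p i)))
    (∏-cong (sym ∘ n≡1+p)))
  (EC-cardinality X p (λ i → subst (HasCardinality (setoid (X i))) (n≡1+p i) (card i)))
  where
  p : Fin (suc m) → ℕ
  p i = n i ∸ 1
  -- A point of `X i` yields an element of `Fin (n i)`, which excludes `n i = 0`; so `n i ∸ 1` is a
  -- true predecessor.
  n≡1+p : ∀ i → n i ≡ suc (p i)
  n≡1+p i with n i | Inverse.to (card i) (inhabited i)
  ... | suc _ | _ = refl
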